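{- Let $n \ge 1$ and $\ell \ge 2$ be integers, and let $x^0=(x^0_1,\dots,x^0_n)\in\mathbb{Z}^n$ satisfy $x^0_1\le\dots\le x^0_n$, have at least one entry that is a multiple of $\ell$, and satisfy $\mathrm{range}(x^0)> \ell$. Let $x^0\to x^1\to\dots\to x^j\to\dots$ be the GM-sequence starting at $x^0$. Then there exists an integer $N\ge 0$ such that $\mathrm{range}(x^j)>\ell$ for all $0\le j\le N$ and $\mathrm{range}(x^j)\le\ell$ for all $j>N$.
   Context: Notation: $[n]=\{1,\dots,n\}$. Entries of vectors are integers and may be negative; $0$ and negative multiples count as multiples of $\ell$. For a vector with $x_1\le\dots\le x_n$, $\mathrm{range}(x)=x_n-x_1$. Pivot: let $x=(x_1,\dots,x_n)$ be an integer vector with $x_1\le \dots\le x_n$ having at least one entry that is a multiple of $\ell$. Among the entries of $x$ that are multiples of $\ell$, take the minimal value; the pivot of $x$, $\mathrm{pivot}(x)\in[n]$, is the largest index $i$ such that $x_i$ equals this value. GM-move: the GM-move $x\to x'$ keeps the pivotal entry ($x'_i=x_i$ for $i=\mathrm{pivot}(x)$) and reduces each of the other $n-1$ entries by $1$ ($x'_k=x_k-1$ for $k\ne i$). The vector $x'$ again satisfies $x'_1\le\dots\le x'_n$ and has an entry that is a multiple of $\ell$. The GM-sequence starting at $x^0$ is the infinite sequence $x^0\to x^1\to x^2\to\dots$ of successive GM-moves. -}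

module Defs where

open import Data.Bool using (if_then_else_)
open import Data.Empty using (⊥-elim)
open import Data.Fin as Fin using (Fin; zero; suc; fromℕ)
import Data.Fin.Properties as Fin
open import Data.Integer as ℤ using (ℤ; +_; 1ℤ; _-_)
import Data.Integer.Properties as ℤ
open import Data.Integer.Divisibility using (_∣_)
open import Data.Nat as ℕ using (ℕ; zero; suc; NonZero)
import Data.Nat.Divisibility as ℕ
open import Data.Product using (∃; _×_; _,_; proj₁; proj₂)
open import Data.Sum using (_⊎_; inj₁; inj₂)
open import Data.Vec.Functional using (Vector)
open import Relation.Binary.Definitions using (Monotonic₁)
open import Relation.Binary.PropositionalEquality using (_≡_; refl; sym; subst)
open import Relation.Nullary using (¬_; yes; no; does)

Sorted : ∀ {n} → Vector ℤ n → Set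
Sorted = Monotonic₁ Fin._≤_ ℤ._≤_

-- Only meaningful as max − min when x is sorted.
range : ∀ {n} .{{_ : NonZero n}} → Vector ℤ n → ℤ
range {suc n} x = x (fromℕ n) - x zero

HasMultiple : ℕ → ∀ {n} → Vector ℤ n → Set
HasMultiple ℓ x = ∃ λ i → + ℓ ∣ x i

record IsPivot (ℓ : ℕ) {n} (x : Vector ℤ n) (i : Fin n) : Set where
  field
    multiple : + ℓ ∣ x i
    minimal  : ∀ k → + ℓ ∣ x k → x i ℤ.≤ x k
    largest  : ∀ k → x k ≡ x i → k Fin.≤ i

open IsPivot

private
  findPivot : ∀ ℓ {n} (x : Vector ℤ n) → ∃ (IsPivot ℓ x) ⊎ (∀ i → ¬ (+ ℓ ∣ x i))
  findPivot ℓ {zero}  x = inj₂ λ ()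
  findPivot ℓ {suc n} x with findPivot ℓ (λ i → x (suc i)) | ℓ ℕ.∣? ℤ.∣ x zero ∣
  ... | inj₂ none | no ℓ∤x₀ = inj₂ λ { zero → ℓ∤x₀ ; (suc i) → none i }
  ... | inj₂ none | yes ℓ∣x₀ = inj₁ (zero , record
    { multiple = ℓ∣x₀
    ; minimal  = λ { zero _ → ℤ.≤-refl ; (suc k) d → ⊥-elim (none k d) }
    ; largest  = λ { zero _ → ℕ.z≤n
                   ; (suc k) eq → ⊥-elim (none k (subst (+ ℓ ∣_) (sym eq) ℓ∣x₀)) }
    })
  ... | inj₁ (p , P) | no ℓ∤x₀ = inj₁ (suc p , record
    { multiple = multiple P
    ; minimal  = λ { zero d → ⊥-elim (ℓ∤x₀ d) ; (suc k) d → minimal P k d }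
    ; largest  = λ { zero _ → ℕ.z≤n ; (suc k) eq → ℕ.s≤s (largest P k eq) }
    })
  ... | inj₁ (p , P) | yes ℓ∣x₀ with x zero ℤ.<? x (suc p)
  ...   | yes x₀<xₚ = inj₁ (zero , record
    { multiple = ℓ∣x₀
    ; minimal  = λ { zero _ → ℤ.≤-refl
                   ; (suc k) d → ℤ.≤-trans (ℤ.<⇒≤ x₀<xₚ) (minimal P k d) }
    ; largest  = λ { zero _ → ℕ.z≤n
                   ; (suc k) eq → ⊥-elim (ℤ.<⇒≱ x₀<xₚ
                       (subst (x (suc p) ℤ.≤_) eq
                         (minimal P k (subst (+ ℓ ∣_) (sym eq) ℓ∣x₀)))) }
    })
  ...   | no x₀≮xₚ = inj₁ (suc p , record
    { multiple = multiple P
    ; minimal  = λ { zero _ → ℤ.≮⇒≥ x₀≮xₚ ; (suc k) d → minimal P k d }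
    ; largest  = λ { zero _ → ℕ.z≤n ; (suc k) eq → ℕ.s≤s (largest P k eq) }
    })

  pivotWithProof : ∀ ℓ {n} (x : Vector ℤ n) → HasMultiple ℓ x → ∃ (IsPivot ℓ x)
  pivotWithProof ℓ x (i , ℓ∣xᵢ) with findPivot ℓ x
  ... | inj₁ p    = p
  ... | inj₂ none = ⊥-elim (none i ℓ∣xᵢ)

-- IsPivot ℓ x holds of at most one index, so pivot-isPivot determines pivot;
-- in particular pivot does not depend on the given witness of HasMultiple.
pivot : ∀ ℓ {n} (x : Vector ℤ n) → HasMultiple ℓ x → Fin n
pivot ℓ x h = proj₁ (pivotWithProof ℓ x h)

pivot-isPivot : ∀ ℓ {n} (x : Vector ℤ n) (h : HasMultiple ℓ x) → IsPivot ℓ x (pivot ℓ x h)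
pivot-isPivot ℓ x h = proj₂ (pivotWithProof ℓ x h)

gmMove : ∀ ℓ {n} (x : Vector ℤ n) → HasMultiple ℓ x → Vector ℤ n
gmMove ℓ x h k = if does (k Fin.≟ pivot ℓ x h) then x k else x k - 1ℤ

gmMove-hasMultiple : ∀ ℓ {n} (x : Vector ℤ n) (h : HasMultiple ℓ x) →
                     HasMultiple ℓ (gmMove ℓ x h)
gmMove-hasMultiple ℓ x h = pivot ℓ x h , fixed
  where
  fixed : + ℓ ∣ gmMove ℓ x h (pivot ℓ x h)
  fixed with pivot ℓ x h Fin.≟ pivot ℓ x h
  ... | yes _ = multiple (pivot-isPivot ℓ x h)
  ... | no ≢  = ⊥-elim (≢ refl)

mutual
  gmSequence : ∀ ℓ {n} (x⁰ : Vector ℤ n) → HasMultiple ℓ x⁰ → ℕ → Vector ℤ n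
  gmSequence ℓ x⁰ h zero    = x⁰
  gmSequence ℓ x⁰ h (suc j) = gmMove ℓ (gmSequence ℓ x⁰ h j) (gmSequence-hasMultiple ℓ x⁰ h j)

  gmSequence-hasMultiple : ∀ ℓ {n} (x⁰ : Vector ℤ n) (h : HasMultiple ℓ x⁰) j →
                           HasMultiple ℓ (gmSequence ℓ x⁰ h j)
  gmSequence-hasMultiple ℓ x⁰ h zero    = h
  gmSequence-hasMultiple ℓ x⁰ h (suc j) =
    gmMove-hasMultiple ℓ (gmSequence ℓ x⁰ h j) (gmSequence-hasMultiple ℓ x⁰ h j)

{-# OPTIONS --safe #-}

-- A move changes the range only if the pivot is the first or the last index.
-- If it is the last index, then no entry below x_n is a multiple of ℓ, so a
-- range of at most ℓ is in fact less than ℓ; hence range ≤ ℓ is preserved.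
-- For termination, the first entry reaches a multiple of ℓ after at most ℓ − 1
-- moves. From then on some multiple of ℓ lies in [x_1, x_1 + ℓ), so while the
-- range exceeds ℓ the pivot is not the last index, and every move lowers the
-- nonnegative quantity Σ_k (x_n − x_k) by exactly 1.
module Submission where

open import Defs
open import Algebra.Properties.CommutativeMonoid.Sum using (sum; sum-cong-≗; sum-remove)
open import Data.Bool using (if_then_else_)
open import Data.Fin as Fin using (Fin; zero; suc; fromℕ; punchIn)
import Data.Fin.Properties as Fin
open import Data.Integer as ℤ using (ℤ; +_; 0ℤ; 1ℤ; _+_; _-_; -_)
import Data.Integer.DivMod as ℤ
open import Data.Integer.Divisibility using (_∣_)
import Data.Integer.Divisibility.Signed as Signed
import Data.Integer.Properties as ℤ
open import Data.Integer.Tactic.RingSolver using (solve-∀)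
open import Data.Nat as ℕ using (ℕ; zero; suc; NonZero)
import Data.Nat.Properties as ℕ
open import Data.Product using (∃; _×_; _,_)
open import Data.Vec.Functional using (Vector; removeAt)
open import Relation.Binary.PropositionalEquality
open import Relation.Nullary using (¬_; Dec; yes; no; contradiction)
open import Relation.Nullary.Decidable using (dec-true; dec-false)
open import Relation.Unary using (Decidable)

open IsPivot

-- Descends from a known witness of `P`. As `P` passes to successors, the first failure met on the
-- way down separates the indices where `P` fails from those where it holds.
last-before : (P : ℕ → Set) → Decidable P → (∀ j → P j → P (suc j)) →
              ¬ P 0 → ∀ k → P k →
              ∃ λ N → (∀ j → j ℕ.≤ N → ¬ P j) × (∀ j → N ℕ.< j → P j)
last-before P P? step ¬P₀ zero    P₀ = contradiction P₀ ¬P₀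
last-before P P? step ¬P₀ (suc k) Pₛ with P? k
... | yes Pₖ = last-before P P? step ¬P₀ k Pₖ
... | no ¬Pₖ = k , (λ j j≤k Pⱼ → ¬Pₖ (upward j≤k Pⱼ)) , λ j k<j → upward k<j Pₛ
  where
  upward : ∀ {i j} → i ℕ.≤ j → P i → P j
  upward i≤j = go (ℕ.≤⇒≤′ i≤j)
    where
    go : ∀ {i j} → i ℕ.≤′ j → P i → P j
    go ℕ.≤′-refl       Pᵢ = Pᵢ
    go (ℕ.≤′-step i≤j) Pᵢ = step _ (go i≤j Pᵢ)

-- Integer arithmetic, finite sums and the termination measure.

i<j⇒i≤j-1 : ∀ {i j} → i ℤ.< j → i ℤ.≤ j - 1ℤ
i<j⇒i≤j-1 {i} {j} i<j = subst (i ℤ.≤_) (ℤ.+-comm ℤ.-1ℤ j) (ℤ.i<j⇒i≤pred[j] i<j)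

i-1<i : ∀ i → i - 1ℤ ℤ.< i
i-1<i i = ℤ.i≤pred[j]⇒i<j (ℤ.≤-reflexive (ℤ.+-comm i ℤ.-1ℤ))

j+[i-j]≡i : ∀ i j → j + (i - j) ≡ i
j+[i-j]≡i = solve-∀

[i-k]-[j-k]≡i-j : ∀ i j k → (i - k) - (j - k) ≡ i - j
[i-k]-[j-k]≡i-j = solve-∀

[i+j]-k≡[i-k]+j : ∀ i j k → (i + j) - k ≡ (i - k) + j
[i+j]-k≡[i-k]+j = solve-∀

ℤ-sum : ∀ {n} → Vector ℤ n → ℤ
ℤ-sum = sum ℤ.+-0-commutativeMonoid

sum-nonNeg : ∀ {n} (f : Vector ℤ n) → (∀ i → 0ℤ ℤ.≤ f i) → 0ℤ ℤ.≤ ℤ-sum f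
sum-nonNeg {zero}  f 0≤f = ℤ.≤-refl
sum-nonNeg {suc n} f 0≤f = ℤ.+-mono-≤ (0≤f zero) (sum-nonNeg (λ i → f (suc i)) λ i → 0≤f (suc i))

sum-lower-at : ∀ {n} (f g : Vector ℤ (suc n)) p → g p ≡ f p - 1ℤ →
               (∀ k → k ≢ p → g k ≡ f k) → ℤ-sum g ≡ ℤ-sum f - 1ℤ
sum-lower-at f g p gₚ≡ g≡f = begin
  ℤ-sum g                              ≡⟨ sum-remove ℤ.+-0-commutativeMonoid {i = p} g ⟩
  g p + ℤ-sum (removeAt g p)           ≡⟨ cong₂ _+_ gₚ≡ (sum-cong-≗ ℤ.+-0-commutativeMonoid
                                            λ k → g≡f (punchIn p k) (Fin.punchInᵢ≢i p k)) ⟩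
  (f p - 1ℤ) + ℤ-sum (removeAt f p)    ≡⟨ [i+j]-k≡[i-k]+j (f p) _ 1ℤ ⟨
  (f p + ℤ-sum (removeAt f p)) - 1ℤ    ≡⟨ cong (_- 1ℤ) (sum-remove ℤ.+-0-commutativeMonoid {i = p} f) ⟨
  ℤ-sum f - 1ℤ                         ∎
  where
  open ≡-Reasoning

deficit : ∀ {n} → Vector ℤ (suc n) → ℤ
deficit {n} x = ℤ-sum λ k → x (fromℕ n) - x k

deficit-nonNeg : ∀ {n} (x : Vector ℤ (suc n)) → Sorted x → 0ℤ ℤ.≤ deficit x
deficit-nonNeg x sorted = sum-nonNeg _ λ k → ℤ.i≤j⇒0≤j-i (sorted (Fin.≤fromℕ k))

-- For sorted `x` this places a multiple of `ℓ` in [x_1, x_1 + ℓ): the lower bound comes from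
-- sortedness.
MultipleNearFirst : ℕ → ∀ {n} → Vector ℤ (suc n) → Set
MultipleNearFirst ℓ x = ∃ λ k → + ℓ ∣ x k × x k ℤ.< x zero + + ℓ

multiple-first : ∀ ℓ {n} .{{_ : NonZero ℓ}} (x : Vector ℤ (suc n)) →
                 + ℓ ∣ x zero → MultipleNearFirst ℓ x
multiple-first ℓ x ℓ∣x₀ = zero , ℓ∣x₀ , subst (ℤ._< x zero + + ℓ) (ℤ.+-identityʳ (x zero))
  (ℤ.+-monoʳ-< (x zero) (ℤ.+<+ (ℕ.>-nonZero⁻¹ ℓ)))

i≡j+k∧k∣i⇒k∣j : ∀ {i} j k → i ≡ j + k → k ∣ i → k ∣ j
i≡j+k∧k∣i⇒k∣j j k refl k∣i =
  Signed.∣⇒∣ᵤ (Signed.∣m+n∣n⇒∣m {m = j} (Signed.∣ᵤ⇒∣ k∣i) (Signed.∣-refl {k}))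

-- Effect of a single GM-move.

module _ (ℓ : ℕ) {n} (x : Vector ℤ (suc n)) (h : HasMultiple ℓ x) where

  private
    p   = pivot ℓ x h
    isP = pivot-isPivot ℓ x h
    x′  = gmMove ℓ x h
    ω   = fromℕ n

  gmMove-pivot : x′ p ≡ x p
  gmMove-pivot = cong (if_then x p else x p - 1ℤ) (dec-true (p Fin.≟ p) refl)

  gmMove-other : ∀ {k} → k ≢ p → x′ k ≡ x k - 1ℤ
  gmMove-other {k} k≢p = cong (if_then x k else x k - 1ℤ) (dec-false (k Fin.≟ p) k≢p)

  gmMove-≥ : ∀ k → x k - 1ℤ ℤ.≤ x′ k
  gmMove-≥ k with k Fin.≟ p
  ... | yes refl = ℤ.<⇒≤ (i-1<i (x k))
  ... | no  _    = ℤ.≤-refl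

  gmMove-≤ : ∀ k → x′ k ℤ.≤ x k
  gmMove-≤ k with k Fin.≟ p
  ... | yes refl = ℤ.≤-refl
  ... | no  _    = ℤ.<⇒≤ (i-1<i (x k))

  gmMove-sorted : Sorted x → Sorted x′
  gmMove-sorted sorted {i} {j} i≤j = by-cases (i Fin.≟ p) (j Fin.≟ p)
    where
    by-cases : Dec (i ≡ p) → Dec (j ≡ p) → x′ i ℤ.≤ x′ j
    by-cases (yes refl) (yes refl) = ℤ.≤-refl
    -- The only case where the order is at risk: the left entry stays and the right one drops. The
    -- pivot is the largest index with its value, so x_j exceeds it by at least 1.
    by-cases (yes refl) (no j≢p) = subst₂ ℤ._≤_ (sym gmMove-pivot) (sym (gmMove-other j≢p))
      (i<j⇒i≤j-1 (ℤ.≤∧≢⇒< (sorted i≤j) λ xₚ≡xⱼ →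
        j≢p (Fin.≤-antisym (largest isP j (sym xₚ≡xⱼ)) i≤j)))
    by-cases (no _)   (yes refl) = subst (x′ i ℤ.≤_) (sym gmMove-pivot)
      (ℤ.≤-trans (gmMove-≤ i) (sorted i≤j))
    by-cases (no i≢p) (no j≢p) = subst₂ ℤ._≤_ (sym (gmMove-other i≢p)) (sym (gmMove-other j≢p))
      (ℤ.+-monoˡ-≤ (- 1ℤ) (sorted i≤j))

  gmMove-range≤ : .{{NonZero ℓ}} → range x ℤ.≤ + ℓ → range x′ ℤ.≤ + ℓ
  gmMove-range≤ range≤ℓ = by-cases (ω Fin.≟ p)
    where
    open ℤ.≤-Reasoning
    regroup : ∀ a b c → a - (b - c) ≡ c + (a - b)
    regroup = solve-∀

    -- If the range were exactly `ℓ`, the first entry would be a multiple along with the last one.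
    -- Minimality at the pivot would then make the range nonpositive.
    range≢ℓ : ω ≡ p → range x ≢ + ℓ
    range≢ℓ ω≡p range≡ℓ = ℤ.<⇒≱ (ℤ.+<+ (ℕ.>-nonZero⁻¹ ℓ)) (begin
      + ℓ                ≡⟨ range≡ℓ ⟨
      x ω - x zero       ≤⟨ ℤ.i≤j⇒i-j≤0 xω≤x₀ ⟩
      0ℤ                 ∎)
      where
      ℓ∣x₀ : + ℓ ∣ x zero
      ℓ∣x₀ = i≡j+k∧k∣i⇒k∣j (x zero) (+ ℓ)
               (trans (sym (j+[i-j]≡i (x ω) (x zero))) (cong (_+_ (x zero)) range≡ℓ))
               (subst (λ i → + ℓ ∣ x i) (sym ω≡p) (multiple isP))
      xω≤x₀ : x ω ℤ.≤ x zero
      xω≤x₀ = subst (λ i → x i ℤ.≤ x zero) (sym ω≡p) (minimal isP zero ℓ∣x₀)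

    by-cases : Dec (ω ≡ p) → range x′ ℤ.≤ + ℓ
    by-cases (no ω≢p) = begin
      x′ ω - x′ zero               ≡⟨ cong (_- x′ zero) (gmMove-other ω≢p) ⟩
      (x ω - 1ℤ) - x′ zero         ≤⟨ ℤ.+-monoʳ-≤ (x ω - 1ℤ) (ℤ.neg-mono-≤ (gmMove-≥ zero)) ⟩
      (x ω - 1ℤ) - (x zero - 1ℤ)   ≡⟨ [i-k]-[j-k]≡i-j (x ω) (x zero) 1ℤ ⟩
      range x                      ≤⟨ range≤ℓ ⟩
      + ℓ                          ∎
    by-cases (yes ω≡p) = begin
      x′ ω - x′ zero          ≤⟨ ℤ.+-mono-≤ (gmMove-≤ ω) (ℤ.neg-mono-≤ (gmMove-≥ zero)) ⟩
      x ω - (x zero - 1ℤ)     ≡⟨ regroup (x ω) (x zero) 1ℤ ⟩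
      1ℤ + range x            ≤⟨ ℤ.i<j⇒suc[i]≤j (ℤ.≤∧≢⇒< range≤ℓ (range≢ℓ ω≡p)) ⟩
      + ℓ                     ∎

  -- The pivotal value is fixed and was below x_1 + ℓ, a bound that drops by at most 1. Either it is
  -- still below the new bound, or it equals it and the new first entry is itself a multiple.
  gmMove-multipleNearFirst : .{{NonZero ℓ}} → MultipleNearFirst ℓ x → MultipleNearFirst ℓ x′
  gmMove-multipleNearFirst (k , ℓ∣xₖ , xₖ<x₀+ℓ) with x p ℤ.<? x′ zero + + ℓ
  ... | yes xₚ<x′₀+ℓ = p , subst (+ ℓ ∣_) (sym gmMove-pivot) (multiple isP)
                        , subst (ℤ._< x′ zero + + ℓ) (sym gmMove-pivot) xₚ<x′₀+ℓ
  ... | no  xₚ≮x′₀+ℓ = multiple-first ℓ x′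
    (i≡j+k∧k∣i⇒k∣j (x′ zero) (+ ℓ) xₚ≡x′₀+ℓ (multiple isP))
    where
    open ℤ.≤-Reasoning
    xₚ≤x′₀+ℓ : x p ℤ.≤ x′ zero + + ℓ
    xₚ≤x′₀+ℓ = begin
      x p                    ≤⟨ minimal isP k ℓ∣xₖ ⟩
      x k                    ≤⟨ i<j⇒i≤j-1 xₖ<x₀+ℓ ⟩
      (x zero + + ℓ) - 1ℤ    ≡⟨ [i+j]-k≡[i-k]+j (x zero) (+ ℓ) 1ℤ ⟩
      (x zero - 1ℤ) + + ℓ    ≤⟨ ℤ.+-monoˡ-≤ (+ ℓ) (gmMove-≥ zero) ⟩
      x′ zero + + ℓ          ∎
    xₚ≡x′₀+ℓ : x p ≡ x′ zero + + ℓ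
    xₚ≡x′₀+ℓ = ℤ.≤-antisym xₚ≤x′₀+ℓ (ℤ.≮⇒≥ xₚ≮x′₀+ℓ)

  multipleNearFirst⇒last≢pivot : MultipleNearFirst ℓ x → + ℓ ℤ.< range x → ω ≢ p
  multipleNearFirst⇒last≢pivot (k , ℓ∣xₖ , xₖ<x₀+ℓ) ℓ<range ω≡p = ℤ.<-irrefl refl (begin-strict
    x ω                    ≡⟨ cong x ω≡p ⟩
    x p                    ≤⟨ minimal isP k ℓ∣xₖ ⟩
    x k                    <⟨ xₖ<x₀+ℓ ⟩
    x zero + + ℓ           <⟨ ℤ.+-monoʳ-< (x zero) ℓ<range ⟩
    x zero + range x       ≡⟨ j+[i-j]≡i (x ω) (x zero) ⟩
    x ω                    ∎)
    where
    open ℤ.≤-Reasoning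

  -- The last entry drops by 1 together with every non-pivotal one, so only the summand at the pivot
  -- changes.
  gmMove-deficit : ω ≢ p → deficit x′ ≡ deficit x - 1ℤ
  gmMove-deficit ω≢p = sum-lower-at _ _ p
    (trans (cong₂ _-_ (gmMove-other ω≢p) gmMove-pivot) (sym ([i+j]-k≡[i-k]+j (x ω) (- x p) 1ℤ)))
    λ k k≢p → trans (cong₂ _-_ (gmMove-other ω≢p) (gmMove-other k≢p)) ([i-k]-[j-k]≡i-j (x ω) (x k) 1ℤ)

-- Behaviour along the GM-sequence.

module _ (ℓ : ℕ) .{{_ : NonZero ℓ}} {n} (x⁰ : Vector ℤ (suc n)) (h : HasMultiple ℓ x⁰) where

  private
    x = gmSequence ℓ x⁰ h
    H = gmSequence-hasMultiple ℓ x⁰ h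

  gmSequence-sorted : Sorted x⁰ → ∀ j → Sorted (x j)
  gmSequence-sorted sorted zero    = sorted
  gmSequence-sorted sorted (suc j) = gmMove-sorted ℓ (x j) (H j) (gmSequence-sorted sorted j)

  -- Here `r` is the distance from the first entry down to a multiple of `ℓ`. A move shortens it by
  -- 1 unless the first entry is pivotal, and then that entry is already a multiple.
  eventually-multipleNearFirst : ∀ r j → + ℓ ∣ (x j zero - + r) → ∃ λ k → MultipleNearFirst ℓ (x k)
  eventually-multipleNearFirst zero j ℓ∣ =
    j , multiple-first ℓ (x j) (subst (+ ℓ ∣_) (ℤ.+-identityʳ (x j zero)) ℓ∣)
  eventually-multipleNearFirst (suc r) j ℓ∣ with zero Fin.≟ pivot ℓ (x j) (H j)
  ... | yes 0≡p = j , multiple-first ℓ (x j)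
    (subst (λ i → + ℓ ∣ x j i) (sym 0≡p) (multiple (pivot-isPivot ℓ (x j) (H j))))
  ... | no  0≢p = eventually-multipleNearFirst r (suc j) (subst (+ ℓ ∣_) shift ℓ∣)
    where
    regroup : ∀ a b c → a - (b + c) ≡ (a - b) - c
    regroup = solve-∀
    shift : x j zero - + suc r ≡ x (suc j) zero - + r
    shift = trans (regroup (x j zero) 1ℤ (+ r))
                  (cong (_- + r) (sym (gmMove-other ℓ (x j) (H j) 0≢p)))

  -- Induction on `m`, a strict upper bound for the deficit. It falls with each move made while the
  -- range exceeds `ℓ`, and cannot reach 0 because the deficit is nonnegative.
  eventually-range≤ : Sorted x⁰ → ∀ m j → deficit (x j) ℤ.< + m → MultipleNearFirst ℓ (x j) →
                      ∃ λ k → range (x k) ℤ.≤ + ℓ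
  eventually-range≤ sorted zero j deficit<0 _ =
    contradiction (deficit-nonNeg (x j) (gmSequence-sorted sorted j)) (ℤ.<⇒≱ deficit<0)
  eventually-range≤ sorted (suc m) j deficit<1+m near with range (x j) ℤ.≤? + ℓ
  ... | yes range≤ℓ = j , range≤ℓ
  ... | no  range≰ℓ = eventually-range≤ sorted m (suc j) deficit<m
                        (gmMove-multipleNearFirst ℓ (x j) (H j) near)
    where
    deficit<m : deficit (x (suc j)) ℤ.< + m
    deficit<m = subst (ℤ._< + m)
      (sym (gmMove-deficit ℓ (x j) (H j)
        (multipleNearFirst⇒last≢pivot ℓ (x j) (H j) near (ℤ.≰⇒> range≰ℓ))))
      -- The bound `+ suc m - 1ℤ` computes to `+ m`.
      (ℤ.+-monoˡ-< (- 1ℤ) deficit<1+m)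

mainTheorem4 : ∀ (n ℓ : ℕ) .{{_ : NonZero n}} → 2 ℕ.≤ ℓ →
    (x⁰ : Vector ℤ n) → Sorted x⁰ → (h : HasMultiple ℓ x⁰) →
    + ℓ ℤ.< range x⁰ →
    ∃ λ (N : ℕ) →
    (∀ j → j ℕ.≤ N → + ℓ ℤ.< range (gmSequence ℓ x⁰ h j)) ×
    (∀ j → N ℕ.< j → range (gmSequence ℓ x⁰ h j) ℤ.≤ + ℓ)
mainTheorem4 (suc n) ℓ@(suc _) 2≤ℓ x⁰ sorted h ℓ<range =
  let k , range≤ℓ = range≤-somewhere
      N , before , after = last-before (λ j → range (x j) ℤ.≤ + ℓ) (λ j → range (x j) ℤ.≤? + ℓ)
        (λ j → gmMove-range≤ ℓ (x j) (gmSequence-hasMultiple ℓ x⁰ h j))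
        (ℤ.<⇒≱ ℓ<range) k range≤ℓ
  in N , (λ j j≤N → ℤ.≰⇒> (before j j≤N)) , after
  where
  x = gmSequence ℓ x⁰ h

  residue : + ℓ ∣ (x⁰ zero - + (x⁰ zero ℤ.%ℕ ℓ))
  residue = Signed.∣⇒∣ᵤ (Signed.divides (x⁰ zero ℤ./ℕ ℓ)
    (trans (cong (_- + r) (ℤ.a≡a%ℕn+[a/ℕn]*n (x⁰ zero) ℓ)) (cancel (+ r) _)))
    where
    r = x⁰ zero ℤ.%ℕ ℓ
    cancel : ∀ a b → (a + b) - a ≡ b
    cancel = solve-∀

  range≤-somewhere : ∃ λ k → range (x k) ℤ.≤ + ℓ
  -- The omitted argument is the remainder of the first entry modulo `ℓ`, read off from `residue`.
  range≤-somewhere with j , near ← eventually-multipleNearFirst ℓ x⁰ h _ 0 residue =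
    -- The successor makes the bound on the deficit strict.
    eventually-range≤ ℓ x⁰ h sorted (suc ℤ.∣ deficit (x j) ∣) j deficit< near
    where
    deficit< : deficit (x j) ℤ.< + suc ℤ.∣ deficit (x j) ∣
    deficit< = subst (ℤ._< + suc ℤ.∣ deficit (x j) ∣)
      (ℤ.0≤i⇒+∣i∣≡i (deficit-nonNeg (x j) (gmSequence-sorted ℓ x⁰ h sorted j)))
      (ℤ.+<+ ℕ.≤-refl)
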